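{- Let $V(G)$ be a vertex set with distinguished vertices $s\neq t$ and let $n=|V(G)\setminus\{s,t\}|$. Then $m(\mathcal{P}_{n,\leq 2}) = n+2$ and $m(\mathcal{P}_{n,\leq 3}) = \binom{n}{2}+n+2$.
   Context: Fix a finite vertex set $V(G)$ with distinguished vertices $s,t$. Input graphs are directed graphs with vertex set $V(G)$. A monotone switching network is a tuple $\langle G',s',t',\mu'\rangle$ where $G'$ is an undirected multigraph with distinguished vertices $s',t'$, and $\mu'$ assigns to each edge of $G'$ a label of the form $v_1\to v_2$ with $v_1\neq v_2$ in $V(G)$. It accepts an input graph $G$ if there is a path in $G'$ from $s'$ to $t'$ all of whose edge labels are edges of $G$. It is sound if it accepts no input graph without a directed path from $s$ to $t$. Its size is $|V(G')|$. For a set $I$ of input graphs, each containing a directed path from $s$ to $t$, $m(I)$ is the smallest size of a sound monotone switching network accepting every graph in $I$. $\mathcal{P}_{n,l}$ is the set of input graphs $G$ with $E(G)=\{v_0\to v_1,\dots,v_{l-1}\to v_l\}$, where $v_0=s$, $v_l=t$ and $v_0,\dots,v_l$ are distinct vertices of $V(G)$. $\mathcal{P}_{n,\leq l}=\bigcup_{j=1}^{l}\mathcal{P}_{n,j}$. -}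

module Defs where

open import Data.Fin using (Fin; zero; suc; inject₁; fromℕ)
open import Data.Nat using (ℕ; suc; _≤_)
open import Data.Product using (_×_; _,_; ∃-syntax; proj₁; proj₂)
open import Function.Bundles using (_⇔_)
open import Function.Definitions using (Injective)
open import Level using (0ℓ)
open import Relation.Binary using (Rel)
open import Relation.Binary.Construct.Closure.Equivalence using (EqClosure)
open import Relation.Binary.Construct.Closure.ReflexiveTransitive using (Star)
open import Relation.Binary.PropositionalEquality using (_≡_; _≢_)
open import Relation.Nullary using (¬_)
open import Relation.Unary using (Pred; _∈_)

-- The vertex set V(G) is Fin N; an input graph is given by its edge set,
-- as a subset of V(G) × V(G).
InputGraph : ℕ → Set₁
InputGraph N = Rel (Fin N) 0ℓ

HasPath : ∀ {N} → InputGraph N → Fin N → Fin N → Set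
HasPath E s t = Star E s t

-- Edges of the multigraph G′ are indexed by Fin #edges.  The order of the two
-- endpoints of an edge carries no meaning: Accepts traverses edges both ways.
record SwitchingNetwork (N : ℕ) : Set where
  field
    size       : ℕ
    s′ t′      : Fin size
    #edges     : ℕ
    endpoints  : Fin #edges → Fin size × Fin size
    label      : Fin #edges → Fin N × Fin N
    label-≢    : ∀ e → proj₁ (label e) ≢ proj₂ (label e)

open SwitchingNetwork public

Accepts : ∀ {N} → SwitchingNetwork N → InputGraph N → Set
Accepts W E = EqClosure Step (s′ W) (t′ W)
  where
  Step : Rel (Fin (size W)) 0ℓ
  Step x y = ∃[ e ] endpoints W e ≡ (x , y)
                  × E (proj₁ (label W e)) (proj₂ (label W e))

Sound : ∀ {N} → Fin N → Fin N → SwitchingNetwork N → Set₁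
Sound s t W = ∀ E → ¬ HasPath E s t → ¬ Accepts W E

AcceptsAll : ∀ {N} → SwitchingNetwork N → Pred (InputGraph N) 0ℓ → Set₁
AcceptsAll W I = ∀ E → E ∈ I → Accepts W E

-- m(I) = k, as a relation since the minimum need not be computable for an
-- arbitrary predicate I.
record m⟨_,_⟩_≈_ {N} (s t : Fin N) (I : Pred (InputGraph N) 0ℓ) (k : ℕ) : Set₁ where
  field
    attained : ∃[ W ] Sound s t W × AcceptsAll W I × size W ≡ k
    minimal  : ∀ W → Sound s t W → AcceptsAll W I → k ≤ size W

𝒫 : ∀ {N} → Fin N → Fin N → ℕ → Pred (InputGraph N) 0ℓ
𝒫 {N} s t l E =
  ∃[ v ] Injective {A = Fin (suc l)} {B = Fin N} _≡_ _≡_ v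
       × v zero ≡ s
       × v (fromℕ l) ≡ t
       × (∀ x y → E x y ⇔ (∃[ i ] x ≡ v (inject₁ i) × y ≡ v (suc i)))

𝒫≤ : ∀ {N} → Fin N → Fin N → ℕ → Pred (InputGraph N) 0ℓ
𝒫≤ s t l E = ∃[ j ] 1 ≤ j × j ≤ l × E ∈ 𝒫 s t j

{-# OPTIONS --safe #-}
module Submission where

-- Lower bound.  For a set L of inner vertices let J_w(L) ∈ 𝔽₂ record whether w is
-- reachable from s′ when exactly the edges not leaving L ∪ {s} are available; then
-- J_s′ = 1 and, by soundness, J_t′ = 0.  Along an accepting walk for a path graph,
-- the jumps of J on steps labelled p → q add up to [p ∈ L, q ∉ L] as soon as no cut
-- crossed by p → q is crossed by another edge of the path.  Applied to s → t, to
-- a → t in s → a → t, and to a → b in s → a → b → t, this puts 1, [a ∈ L] and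
-- [a ∈ L] − [a, b ∈ L] in the span of the J_w.  Restricted to |L| ≤ k with
-- k = 1, 2, these functions span everything, and J_t′ = 0 accounts for one more vertex.
--
-- Upper bound.  The states are t′ and the sets of at most k inner vertices known to be
-- reachable from s; this accepts every walk from s to t of length at most k + 1.

open import Defs
open import Algebra.Bundles using (CommutativeRing)
open import Algebra.Properties.CommutativeSemigroup using (interchange)
open import Data.Bool using (Bool; true; false; not; _∧_; _xor_; if_then_else_)
open import Data.Bool.Properties as Bool using (xor-∧-commutativeRing)
open import Data.Empty using (⊥)
open import Data.Fin using (Fin; zero; suc; inject₁; fromℕ; punchIn; punchOut; combine; finToFun; funToFin)
open import Data.Fin.Permutation using (Permutation; _⟨$⟩ʳ_; _⟨$⟩ˡ_; inverseˡ; inverseʳ; insert-punchIn)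
import Data.Fin.Permutation as Perm
open import Data.Fin.Properties
  using (_≟_; suc-injective; 0≢1+n; 2↔Bool; +↔⊎; *↔×; injective⇒≤; sequence; funToFin-finToFin; finToFun-funToFin
        ; punchInᵢ≢i; punchIn-punchOut)
open import Data.Fin.Subset using (Subset; inside; outside; ⊤; ⁅_⁆; _∪_; _─_; _-_; ∣_∣) renaming (_∈_ to _∈ₛ_)
open import Data.Fin.Subset.Properties using (∈⊤; ∣⊤∣≡n; p─⊥≡p; p─q─r≡p─q∪r; x∈p∧x≢y⇒x∈p-y)
open import Data.Nat using (ℕ; zero; suc; _+_; _*_; _^_; _≤_; _<_; z≤n; s≤s; s≤s⁻¹)
open import Data.Nat.Combinatorics using (_C_; nC1≡n; nCk+nC[k+1]≡[n+1]C[k+1])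
open import Data.Nat.Properties
  using (+-comm; +-assoc; ≤-refl; ≤-trans; n≤1+n; ≤-reflexive; m≤m+n; +-suc; +-monoʳ-≤; ≰⇒>; <⇒≱; ^-monoʳ-<; _≤?_)
open import Data.Product using (_×_; _,_; ∃-syntax; proj₁; proj₂)
open import Data.Product.Function.NonDependent.Propositional using (_×-↔_)
open import Data.Sum using (_⊎_; inj₁; inj₂)
open import Data.Sum.Function.Propositional using (_⊎-↔_)
open import Data.Vec using (Vec; []; _∷_; here; there; lookup)
open import Data.Vec.Relation.Unary.AllPairs using ([]; _∷_)
open import Data.Vec.Relation.Unary.Unique.Propositional using (Unique)
open import Data.Vec.Relation.Unary.Unique.Propositional.Properties using (lookup-injective)
open import Data.Vec.Relation.Unary.All using ([]; _∷_)
open import Effect.Monad using (RawMonad)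
open import Function using (case_of_; _∘_; _$_; id; _↔_; mk↔ₛ′; _⇔_; mk⇔; Equivalence; Injection; Inverse)
open import Function.Properties.Inverse using (↔⇒↣; ↔-refl; ↔-trans)
open import Function.Properties.Equivalence using (⇔-isEquivalence)
open import Level using (0ℓ)
open import Relation.Binary using (Rel; IsEquivalence)
open import Relation.Binary.Construct.Closure.Equivalence using (EqClosure; gfold)
open import Relation.Binary.Construct.Closure.ReflexiveTransitive using (Star; ε; _◅_; _◅◅_)
open import Relation.Binary.Construct.Closure.Symmetric using (fwd; bwd)
open import Relation.Binary.PropositionalEquality
open import Relation.Nullary using (¬_; Dec; yes; no; does; contradiction)
open import Relation.Nullary.Decidable using (does-⇔; dec-true; dec-false; dec-yes; decidable-stable; ¬¬-excluded-middle)
open import Relation.Nullary.Negation using (¬¬-Monad; ¬¬-map)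
open import Relation.Unary using (_∈_)

-- Bounded subsets

-- The first index bounds the number of elements and only `keep` spends it. Each subset within the
-- bound has exactly one representation, and no proof of smallness is carried along.
data Subset≤ : ℕ → ℕ → Set where
  []   : ∀ {k} → Subset≤ k 0
  skip : ∀ {k n} → Subset≤ k n → Subset≤ k (suc n)
  keep : ∀ {k n} → Subset≤ k n → Subset≤ (suc k) (suc n)

-- The sum of the binomial coefficients C(n, i) over i ≤ k, computed by Pascal's rule.
#subsets : ℕ → ℕ → ℕ
#subsets k       zero    = 1
#subsets zero    (suc n) = #subsets zero n
#subsets (suc k) (suc n) = #subsets (suc k) n + #subsets k n

#subsets-0 : ∀ n → #subsets 0 n ≡ 1
#subsets-0 zero    = refl
#subsets-0 (suc n) = #subsets-0 n

#subsets-1 : ∀ n → #subsets 1 n ≡ n + 1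
#subsets-1 zero    = refl
#subsets-1 (suc n) = trans (cong₂ _+_ (#subsets-1 n) (#subsets-0 n)) (+-comm (n + 1) 1)

#subsets-2 : ∀ n → #subsets 2 n ≡ n C 2 + n + 1
#subsets-2 zero    = refl
#subsets-2 (suc n) = begin
  #subsets 2 n + #subsets 1 n   ≡⟨ cong₂ _+_ (#subsets-2 n) (#subsets-1 n) ⟩
  n C 2 + n + 1 + (n + 1)       ≡⟨ cong (n C 2 + n + 1 +_) (+-comm n 1) ⟩
  n C 2 + n + 1 + suc n         ≡⟨ +-assoc (n C 2 + n) 1 (suc n) ⟩
  n C 2 + n + (1 + suc n)       ≡⟨ cong (n C 2 + n +_) (+-comm 1 (suc n)) ⟩
  n C 2 + n + (suc n + 1)       ≡⟨ +-assoc (n C 2 + n) (suc n) 1 ⟨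
  n C 2 + n + suc n + 1         ≡⟨ cong (λ z → z + suc n + 1) (+-comm (n C 2) n) ⟩
  n + n C 2 + suc n + 1         ≡⟨ cong (λ z → z + n C 2 + suc n + 1) (nC1≡n n) ⟨
  n C 1 + n C 2 + suc n + 1     ≡⟨ cong (λ z → z + suc n + 1) (nCk+nC[k+1]≡[n+1]C[k+1] n 1) ⟩
  suc n C 2 + suc n + 1         ∎
  where open ≡-Reasoning

Subset≤-zero : ∀ {k} → Fin 1 ↔ Subset≤ k 0
Subset≤-zero = mk↔ₛ′ (λ _ → []) (λ _ → zero) (λ { [] → refl }) (λ { zero → refl })

Subset≤-skip : ∀ {n} → Subset≤ 0 n ↔ Subset≤ 0 (suc n)
Subset≤-skip = mk↔ₛ′ skip (λ { (skip S) → S }) (λ { (skip S) → refl }) (λ _ → refl)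

Subset≤-split : ∀ {k n} → (Subset≤ (suc k) n ⊎ Subset≤ k n) ↔ Subset≤ (suc k) (suc n)
Subset≤-split = mk↔ₛ′ (λ { (inj₁ S) → skip S ; (inj₂ S) → keep S })
                      (λ { (skip S) → inj₁ S ; (keep S) → inj₂ S })
                      (λ { (skip S) → refl ; (keep S) → refl })
                      (λ { (inj₁ S) → refl ; (inj₂ S) → refl })

enumerate : ∀ k n → Fin (#subsets k n) ↔ Subset≤ k n
enumerate k       zero    = Subset≤-zero
enumerate zero    (suc n) = ↔-trans (enumerate zero n) Subset≤-skip
enumerate (suc k) (suc n) =
  ↔-trans +↔⊎ (↔-trans (enumerate (suc k) n ⊎-↔ enumerate k n) Subset≤-split)

module _ {k n : ℕ} where
  open Inverse (enumerate k n) public using ()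
    renaming (to to decode; from to encode; strictlyInverseˡ to decode-encode; strictlyInverseʳ to encode-decode)

∅ : ∀ {k n} → Subset≤ k n
∅ {n = zero}  = []
∅ {n = suc n} = skip ∅

infix 8 _∋_ _⊆ᵇ_

_∋_ : ∀ {k n} → Subset≤ k n → Fin n → Bool
skip S ∋ zero  = false
keep S ∋ zero  = true
skip S ∋ suc i = S ∋ i
keep S ∋ suc i = S ∋ i

_⊆ᵇ_ : ∀ {j k n} → Subset≤ j n → Subset≤ k n → Bool
[]     ⊆ᵇ []     = true
skip S ⊆ᵇ skip L = S ⊆ᵇ L
skip S ⊆ᵇ keep L = S ⊆ᵇ L
keep S ⊆ᵇ skip L = false
keep S ⊆ᵇ keep L = S ⊆ᵇ L

∅-∋ : ∀ {k n} (i : Fin n) → ∅ {k} ∋ i ≡ false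
∅-∋ zero    = refl
∅-∋ (suc i) = ∅-∋ i

weaken : ∀ {j k n} → j ≤ k → Subset≤ j n → Subset≤ k n
weaken j≤k       []       = []
weaken j≤k       (skip S) = skip (weaken j≤k S)
weaken (s≤s j≤k) (keep S) = keep (weaken j≤k S)

weaken-∋ : ∀ {j k n} (j≤k : j ≤ k) (S : Subset≤ j n) i → weaken j≤k S ∋ i ≡ S ∋ i
weaken-∋ j≤k       (skip S) zero    = refl
weaken-∋ j≤k       (skip S) (suc i) = weaken-∋ j≤k S i
weaken-∋ (s≤s j≤k) (keep S) zero    = refl
weaken-∋ (s≤s j≤k) (keep S) (suc i) = weaken-∋ j≤k S i

weaken-weaken : ∀ {i j k n} (i≤j : i ≤ j) (j≤k : j ≤ k) (i≤k : i ≤ k) (S : Subset≤ i n) →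
  weaken j≤k (weaken i≤j S) ≡ weaken i≤k S
weaken-weaken i≤j       j≤k       i≤k       []       = refl
weaken-weaken i≤j       j≤k       i≤k       (skip S) = cong skip (weaken-weaken i≤j j≤k i≤k S)
weaken-weaken (s≤s i≤j) (s≤s j≤k) (s≤s i≤k) (keep S) = cong keep (weaken-weaken i≤j j≤k i≤k S)

weaken-∅ : ∀ {j k} (j≤k : j ≤ k) n → weaken j≤k (∅ {n = n}) ≡ ∅
weaken-∅ j≤k zero    = refl
weaken-∅ j≤k (suc n) = cong skip (weaken-∅ j≤k n)

raise : ∀ {k n} → Subset≤ k n → Subset≤ (suc k) n
raise = weaken (n≤1+n _)

-- The bound grows even when the element is already present, so the type does not depend on
-- membership.
insert : ∀ {k n} → Fin n → Subset≤ k n → Subset≤ (suc k) n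
insert zero    (skip S) = keep S
insert zero    (keep S) = keep (raise S)
insert (suc i) (skip S) = skip (insert i S)
insert (suc i) (keep S) = keep (insert i S)

weaken-insert : ∀ {j k n} (j≤k : j ≤ k) i (S : Subset≤ j n) →
  weaken (s≤s j≤k) (insert i S) ≡ insert i (weaken j≤k S)
weaken-insert j≤k       zero    (skip S) = refl
weaken-insert (s≤s j≤k) zero    (keep S) =
  cong keep (trans (weaken-weaken _ (s≤s j≤k) (≤-trans j≤k (n≤1+n _)) S) (sym (weaken-weaken j≤k _ _ S)))
weaken-insert j≤k       (suc i) (skip S) = cong skip (weaken-insert j≤k i S)
weaken-insert (s≤s j≤k) (suc i) (keep S) = cong keep (weaken-insert j≤k i S)

insert-∋-self : ∀ {k n} i (S : Subset≤ k n) → insert i S ∋ i ≡ true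
insert-∋-self zero    (skip S) = refl
insert-∋-self zero    (keep S) = refl
insert-∋-self (suc i) (skip S) = insert-∋-self i S
insert-∋-self (suc i) (keep S) = insert-∋-self i S

insert-∋-other : ∀ {k n} {i j : Fin n} (S : Subset≤ k n) → j ≢ i → insert i S ∋ j ≡ S ∋ j
insert-∋-other {i = zero}  {zero}  S        j≢i = contradiction refl j≢i
insert-∋-other {i = zero}  {suc j} (skip S) j≢i = refl
insert-∋-other {i = zero}  {suc j} (keep S) j≢i = weaken-∋ _ S j
insert-∋-other {i = suc i} {zero}  (skip S) j≢i = refl
insert-∋-other {i = suc i} {zero}  (keep S) j≢i = refl
insert-∋-other {i = suc i} {suc j} (skip S) j≢i = insert-∋-other S (j≢i ∘ cong suc)
insert-∋-other {i = suc i} {suc j} (keep S) j≢i = insert-∋-other S (j≢i ∘ cong suc)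

insert-∋-mono : ∀ {k n} i {j : Fin n} (S : Subset≤ k n) → S ∋ j ≡ true → insert i S ∋ j ≡ true
insert-∋-mono i {j} S j∈S with j ≟ i
... | yes refl = insert-∋-self i S
... | no  j≢i  = trans (insert-∋-other S j≢i) j∈S

⊆ᵇ-≤0 : ∀ {k n} (S : Subset≤ 0 n) (L : Subset≤ k n) → S ⊆ᵇ L ≡ true
⊆ᵇ-≤0 []       []       = refl
⊆ᵇ-≤0 (skip S) (skip L) = ⊆ᵇ-≤0 S L
⊆ᵇ-≤0 (skip S) (keep L) = ⊆ᵇ-≤0 S L

-- With at most one element, the indicator is one of the functions that the paths s → t and s → a →
-- t supply.
⊆ᵇ-≤1 : ∀ {n} (S : Subset≤ 1 n) →
  (∀ {k} (L : Subset≤ k n) → S ⊆ᵇ L ≡ true) ⊎ (∃[ a ] ∀ {k} (L : Subset≤ k n) → S ⊆ᵇ L ≡ L ∋ a)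
⊆ᵇ-≤1 []       = inj₁ λ { [] → refl }
⊆ᵇ-≤1 (skip S) with ⊆ᵇ-≤1 S
... | inj₁ h       = inj₁ λ { (skip L) → h L ; (keep L) → h L }
... | inj₂ (a , h) = inj₂ (suc a , λ { (skip L) → h L ; (keep L) → h L })
⊆ᵇ-≤1 (keep S) = inj₂ (zero , λ { (skip L) → refl ; (keep L) → ⊆ᵇ-≤0 S L })

-- The new case is a pair, handled later by the path s → a → b → t; this is where `a ≢ b` is used.
⊆ᵇ-≤2 : ∀ {n} (S : Subset≤ 2 n) →
  (∃[ S′ ] ∀ {k} (L : Subset≤ k n) → S ⊆ᵇ L ≡ _⊆ᵇ_ {1} S′ L) ⊎
  (∃[ a ] ∃[ b ] a ≢ b × ∀ {k} (L : Subset≤ k n) → S ⊆ᵇ L ≡ L ∋ a ∧ L ∋ b)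
⊆ᵇ-≤2 []       = inj₁ ([] , λ { [] → refl })
⊆ᵇ-≤2 (skip S) with ⊆ᵇ-≤2 S
... | inj₁ (S′ , h) = inj₁ (skip S′ , λ { (skip L) → h L ; (keep L) → h L })
... | inj₂ (a , b , a≢b , h) =
  inj₂ (suc a , suc b , (λ { refl → a≢b refl }) , λ { (skip L) → h L ; (keep L) → h L })
⊆ᵇ-≤2 (keep S) with ⊆ᵇ-≤1 S
... | inj₁ h       = inj₁ (keep ∅ , λ { (skip L) → refl ; (keep L) → trans (h L) (sym (⊆ᵇ-≤0 ∅ L)) })
... | inj₂ (a , h) = inj₂ (zero , suc a , (λ ()) , λ { (skip L) → refl ; (keep L) → h L })

-- Linear algebra over 𝔽₂

⨁ : ∀ {k n} → (Subset≤ k n → Bool) → Bool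
⨁ {n = zero}           f = f []
⨁ {zero}  {n = suc n}  f = ⨁ (λ L → f (skip L))
⨁ {suc k} {n = suc n}  f = ⨁ (λ L → f (skip L)) xor ⨁ (λ L → f (keep L))

⨁-cong : ∀ {k n} {f g : Subset≤ k n → Bool} → (∀ L → f L ≡ g L) → ⨁ f ≡ ⨁ g
⨁-cong {n = zero}          f≗g = f≗g []
⨁-cong {zero}  {n = suc n} f≗g = ⨁-cong (λ L → f≗g (skip L))
⨁-cong {suc k} {n = suc n} f≗g = cong₂ _xor_ (⨁-cong (λ L → f≗g (skip L))) (⨁-cong (λ L → f≗g (keep L)))

⨁-false : ∀ {k n} {f : Subset≤ k n → Bool} → (∀ L → f L ≡ false) → ⨁ f ≡ false
⨁-false {n = zero}          f≗0 = f≗0 []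
⨁-false {zero}  {n = suc n} f≗0 = ⨁-false (λ L → f≗0 (skip L))
⨁-false {suc k} {n = suc n} f≗0 = cong₂ _xor_ (⨁-false (λ L → f≗0 (skip L))) (⨁-false (λ L → f≗0 (keep L)))

⨁-xor : ∀ {k n} (f g : Subset≤ k n → Bool) → ⨁ (λ L → f L xor g L) ≡ ⨁ f xor ⨁ g
⨁-xor {n = zero}          f g = refl
⨁-xor {zero}  {n = suc n} f g = ⨁-xor (λ L → f (skip L)) (λ L → g (skip L))
⨁-xor {suc k} {n = suc n} f g =
  trans (cong₂ _xor_ (⨁-xor (λ L → f (skip L)) (λ L → g (skip L)))
                     (⨁-xor (λ L → f (keep L)) (λ L → g (keep L))))
        (interchange +-commutativeSemigroup
          (⨁ (λ L → f (skip L))) (⨁ (λ L → g (skip L))) (⨁ (λ L → f (keep L))) (⨁ (λ L → g (keep L))))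
  where open CommutativeRing xor-∧-commutativeRing using (+-commutativeSemigroup)

infix 6 ⟨_,_⟩

⟨_,_⟩ : ∀ {k n} → (d f : Subset≤ k n → Bool) → Bool
⟨ d , f ⟩ = ⨁ (λ L → d L ∧ f L)

⟨⟩-congʳ : ∀ {k n} (d : Subset≤ k n → Bool) {f g} → (∀ L → f L ≡ g L) → ⟨ d , f ⟩ ≡ ⟨ d , g ⟩
⟨⟩-congʳ d f≗g = ⨁-cong (λ L → cong (d L ∧_) (f≗g L))

⟨⟩-xorʳ : ∀ {k n} (d f g : Subset≤ k n → Bool) → ⟨ d , (λ L → f L xor g L) ⟩ ≡ ⟨ d , f ⟩ xor ⟨ d , g ⟩
⟨⟩-xorʳ d f g = trans (⨁-cong (λ L → Bool.∧-distribˡ-xor (d L) (f L) (g L))) (⨁-xor (λ L → d L ∧ f L) (λ L → d L ∧ g L))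

⟨⟩-xorˡ : ∀ {k n} (d e f : Subset≤ k n → Bool) → ⟨ (λ L → d L xor e L) , f ⟩ ≡ ⟨ d , f ⟩ xor ⟨ e , f ⟩
⟨⟩-xorˡ d e f = trans (⨁-cong (λ L → Bool.∧-distribʳ-xor (f L) (d L) (e L))) (⨁-xor (λ L → d L ∧ f L) (λ L → e L ∧ f L))

xor≡false⇒≡ : ∀ x y → x xor y ≡ false → x ≡ y
xor≡false⇒≡ false false _ = refl
xor≡false⇒≡ true  true  _ = refl

≡⇒xor≡false : ∀ {x y} → x ≡ y → x xor y ≡ false
≡⇒xor≡false {x} refl = Bool.xor-same x

-- Möbius inversion on the truncated Boolean lattice, over 𝔽₂.
superset-sums-vanish : ∀ {k n} (d : Subset≤ k n → Bool) →
  (∀ (S : Subset≤ k n) → ⟨ d , S ⊆ᵇ_ ⟩ ≡ false) → ∀ S → d S ≡ false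
superset-sums-vanish {n = zero} d h [] = trans (sym (Bool.∧-identityʳ (d []))) (h [])
superset-sums-vanish {zero} {suc n} d h (skip S) =
  superset-sums-vanish (λ L → d (skip L)) (λ S → h (skip S)) S
superset-sums-vanish {suc k} {suc n} d h = λ { (skip S) → skip-vanish S ; (keep S) → keep-vanish S }
  where
  keep-vanish : ∀ S → d (keep S) ≡ false
  -- This half comes first: a set containing the first element lies only in sets that contain it
  -- too, so the sum for `keep S` has no terms from `skip`.
  keep-vanish = superset-sums-vanish (λ L → d (keep L)) λ S →
    trans (cong (_xor ⟨ (λ L → d (keep L)) , S ⊆ᵇ_ ⟩) (sym (⨁-false {k = suc k} (λ L → Bool.∧-zeroʳ (d (skip L))))))
          (h (keep S))

  skip-vanish : ∀ S → d (skip S) ≡ false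
  skip-vanish = superset-sums-vanish (λ L → d (skip L)) λ S → begin
    ⟨ (λ L → d (skip L)) , S ⊆ᵇ_ ⟩            ≡⟨ Bool.xor-identityʳ _ ⟨
    ⟨ (λ L → d (skip L)) , S ⊆ᵇ_ ⟩ xor false  ≡⟨ cong (⟨ (λ L → d (skip L)) , S ⊆ᵇ_ ⟩ xor_)
                                                 (⨁-false (λ L → cong (_∧ S ⊆ᵇ L) (keep-vanish L))) ⟨
    ⟨ d , skip S ⊆ᵇ_ ⟩                        ≡⟨ h (skip S) ⟩
    false                                     ∎
    where open ≡-Reasoning

^-cancelʳ-≤ : ∀ m {a b} → 1 < m → m ^ a ≤ m ^ b → a ≤ b
^-cancelʳ-≤ m {a} {b} 1<m mᵃ≤mᵇ with a ≤? b
... | yes a≤b = a≤b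
... | no  a≰b = contradiction mᵃ≤mᵇ (<⇒≱ (^-monoʳ-< m 1<m (≰⇒> a≰b)))

open Inverse 2↔Bool using () renaming (to to toBool; from to fromBool; strictlyInverseˡ to toBool-fromBool)

toBool-injective : ∀ {x y} → toBool x ≡ toBool y → x ≡ y
toBool-injective = Injection.injective (↔⇒↣ 2↔Bool)

funToFin-cong : ∀ {m n} {f g : Fin m → Fin n} → (∀ i → f i ≡ g i) → funToFin f ≡ funToFin g
funToFin-cong {zero}  f≗g = refl
funToFin-cong {suc m} f≗g = cong₂ combine (f≗g zero) (funToFin-cong (λ i → f≗g (suc i)))

-- Counting replaces a dimension argument: coding bit vectors as numbers gives 2 ^ a ≤ 2 ^ b.
-- Vectors are compared pointwise, which avoids function extensionality.
Bool^-injection⇒≤ : ∀ {a b} (Φ : (Fin a → Bool) → Fin b → Bool) →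
  (∀ f g → (∀ i → Φ f i ≡ Φ g i) → ∀ i → f i ≡ g i) → a ≤ b
Bool^-injection⇒≤ {a} {b} Φ Φ-injective = ^-cancelʳ-≤ 2 (s≤s (s≤s z≤n)) (injective⇒≤ {f = Ψ} Ψ-injective)
  where
  bits : ∀ m → Fin (2 ^ m) → Fin m → Bool
  bits m c i = toBool (finToFun {2} {m} c i)

  unbits : ∀ m → (Fin m → Bool) → Fin (2 ^ m)
  unbits m f = funToFin (λ i → fromBool (f i))

  bits-unbits : ∀ m (f : Fin m → Bool) i → bits m (unbits m f) i ≡ f i
  bits-unbits m f i = trans (cong toBool (finToFun-funToFin (λ i → fromBool (f i)) i)) (toBool-fromBool (f i))

  bits-injective : ∀ {m} (c c′ : Fin (2 ^ m)) → (∀ i → bits m c i ≡ bits m c′ i) → c ≡ c′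
  bits-injective {m} c c′ h = trans (sym (funToFin-finToFin {m} {2} c))
    (trans (funToFin-cong {m} {2} {finToFun {2} {m} c} {finToFun {2} {m} c′} (λ i → toBool-injective (h i))) (funToFin-finToFin {m} {2} c′))

  Ψ : Fin (2 ^ a) → Fin (2 ^ b)
  Ψ c = unbits b (Φ (bits a c))

  Ψ-injective : ∀ {c c′} → Ψ c ≡ Ψ c′ → c ≡ c′
  Ψ-injective {c} {c′} eq = bits-injective {a} c c′ (Φ-injective (bits a c) (bits a c′) λ i →
    trans (sym (bits-unbits b (Φ (bits a c)) i)) (trans (cong (λ z → bits b z i) eq) (bits-unbits b (Φ (bits a c′)) i)))

xor-cancelˡ : ∀ x {y z} → x xor y ≡ x xor z → y ≡ z
xor-cancelˡ false eq = eq
xor-cancelˡ true  eq = Bool.not-injective eq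

-- Adjoining a constant coordinate to every ρ w, with coefficient f zero, makes
-- the zero vector ρ w₀ count towards the rank as well.
separating⇒suc-#subsets≤ : ∀ {k n m} (ρ : Fin m → Subset≤ k n → Bool) →
  (∃[ w₀ ] ∀ L → ρ w₀ L ≡ false) →
  (∀ d → (∀ w → ⟨ d , ρ w ⟩ ≡ false) → ∀ L → d L ≡ false) →
  suc (#subsets k n) ≤ m
separating⇒suc-#subsets≤ {k} {n} {m} ρ (w₀ , ρw₀) ker = Bool^-injection⇒≤ Φ Φ-injective
  where
  coeff : (Fin (suc (#subsets k n)) → Bool) → Subset≤ k n → Bool
  coeff f L = f (suc (encode L))

  Φ : (Fin (suc (#subsets k n)) → Bool) → Fin m → Bool
  Φ f w = f zero xor ⟨ coeff f , ρ w ⟩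

  Φ-w₀ : ∀ f → Φ f w₀ ≡ f zero
  Φ-w₀ f = trans (cong (f zero xor_)
                   (⨁-false (λ L → trans (cong (coeff f L ∧_) (ρw₀ L)) (Bool.∧-zeroʳ _))))
                 (Bool.xor-identityʳ _)

  Φ-injective : ∀ f g → (∀ w → Φ f w ≡ Φ g w) → ∀ i → f i ≡ g i
  Φ-injective f g Φ≗ = same
    where
    zero≡ : f zero ≡ g zero
    zero≡ = trans (sym (Φ-w₀ f)) (trans (Φ≗ w₀) (Φ-w₀ g))

    pairing≡ : ∀ w → ⟨ coeff f , ρ w ⟩ ≡ ⟨ coeff g , ρ w ⟩
    pairing≡ w = xor-cancelˡ (g zero) (trans (cong (_xor ⟨ coeff f , ρ w ⟩) (sym zero≡)) (Φ≗ w))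

    coeff≡ : ∀ L → coeff f L ≡ coeff g L
    coeff≡ L = xor≡false⇒≡ _ _ $ ker (λ L → coeff f L xor coeff g L)
      (λ w → trans (⟨⟩-xorˡ (coeff f) (coeff g) (ρ w)) (≡⇒xor≡false (pairing≡ w))) L

    same : ∀ i → f i ≡ g i
    same zero    = zero≡
    same (suc i) = subst (λ j → f (suc j) ≡ g (suc j)) (encode-decode {k} {n} i) (coeff≡ (decode i))

-- Switching networks

-- Convertible with the local edge relation in the definition of Accepts.
Step : ∀ {N} (W : SwitchingNetwork N) → InputGraph N → Rel (Fin (size W)) 0ℓ
Step W E x y = ∃[ e ] endpoints W e ≡ (x , y) × E (proj₁ (label W e)) (proj₂ (label W e))

¬¬-sequence : ∀ {n} {P : Fin n → Set} → (∀ i → ¬ ¬ P i) → ¬ ¬ (∀ i → P i)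
¬¬-sequence = sequence (RawMonad.rawApplicative ¬¬-Monad)

pathGraph : ∀ {N l} → Vec (Fin N) (suc l) → InputGraph N
pathGraph v x y = ∃[ i ] x ≡ lookup v (inject₁ i) × y ≡ lookup v (suc i)

pathGraph∈𝒫 : ∀ {N l} {s t : Fin N} (v : Vec (Fin N) (suc l)) → Unique v →
  lookup v zero ≡ s → lookup v (fromℕ l) ≡ t → pathGraph v ∈ 𝒫 s t l
pathGraph∈𝒫 v v! v₀≡s vₗ≡t =
  lookup v , (λ {i} {j} → lookup-injective v! i j) , v₀≡s , vₗ≡t , λ _ _ → mk⇔ id id

acceptsAll-anti : ∀ {N l m} {s t : Fin N} W → l ≤ m → AcceptsAll W (𝒫≤ s t m) → AcceptsAll W (𝒫≤ s t l)
acceptsAll-anti W l≤m acc E (j , 1≤j , j≤l , E∈) = acc E (j , 1≤j , ≤-trans j≤l l≤m , E∈)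

-- Vertices are numbered by π so that t is 0, s is 1 and the others follow.
module _ {N n : ℕ} (π : Permutation N (suc (suc n))) where

  target : Fin N
  target = π ⟨$⟩ˡ zero

  vertex : Fin (suc n) → Fin N
  vertex p = π ⟨$⟩ˡ suc p

  source : Fin N
  source = vertex zero

  inner : Fin n → Fin N
  inner a = vertex (suc a)

  π⁻¹-injective : ∀ {i j} → π ⟨$⟩ˡ i ≡ π ⟨$⟩ˡ j → i ≡ j
  π⁻¹-injective eq = trans (sym (inverseʳ π)) (trans (cong (π ⟨$⟩ʳ_) eq) (inverseʳ π))

  -- Cuts, reachability vectors and the rank bound.

  module _ {k : ℕ} where

    -- In the numbering, `skip` leaves t out and `keep` puts s in: this is membership in L ∪ {s}.
    side : Subset≤ k n → Fin N → Bool
    side L v = skip (keep L) ∋ (π ⟨$⟩ʳ v)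

    crossing : Fin N → Fin N → Subset≤ k n → Bool
    crossing p q L = side L p ∧ not (side L q)

    -- The largest input graph with no edge leaving L ∪ {s}.
    cutGraph : Subset≤ k n → InputGraph N
    cutGraph L p q = crossing p q L ≡ false

    side-π⁻¹ : ∀ L i → side L (π ⟨$⟩ˡ i) ≡ skip (keep L) ∋ i
    side-π⁻¹ L i = cong (skip (keep L) ∋_) (inverseʳ π)

    cutGraph-disconnects : ∀ L → ¬ HasPath (cutGraph L) source target
    cutGraph-disconnects L path =
      case trans (sym (stays path (side-π⁻¹ L (suc zero)))) (side-π⁻¹ L zero) of λ ()
      where
      stays : ∀ {x y} → Star (cutGraph L) x y → side L x ≡ true → side L y ≡ true
      stays ε x∈ = x∈
      stays {x} (_◅_ {j = z} x→z p) x∈ = stays p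
        (Bool.not-injective (trans (cong (_∧ not (side L z)) (sym x∈)) x→z))

    -- On a cut crossed by p → q, every other edge of `E` then belongs to `cutGraph L`, so a step
    -- with such a label cannot change reachability there.
    SoleCrossing : InputGraph N → Fin N → Fin N → Set
    SoleCrossing E p q = ∀ {x y} → E x y → ¬ (x ≡ p × y ≡ q) →
      ∀ L → crossing p q L ≡ true → crossing x y L ≡ false

    module _ (W : SwitchingNetwork N) (sound : Sound source target W)
      (reachable? : ∀ w L → Dec (EqClosure (Step W (cutGraph L)) (s′ W) w))
      where

      ρ : Fin (size W) → Subset≤ k n → Bool
      ρ w L = does (reachable? w L)

      ρ-s′ : ∀ L → ρ (s′ W) L ≡ true
      ρ-s′ L = dec-true (reachable? (s′ W) L) ε

      ρ-t′ : ∀ L → ρ (t′ W) L ≡ false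
      ρ-t′ L = dec-false (reachable? (t′ W) L) (sound (cutGraph L) (cutGraph-disconnects L))

      ρ-step : ∀ {x y} L → Step W (cutGraph L) x y → ρ x L ≡ ρ y L
      ρ-step {x} {y} L st =
        does-⇔ (mk⇔ (_◅◅ (fwd st ◅ ε)) (_◅◅ (bwd st ◅ ε))) (reachable? x L) (reachable? y L)

      module _ (d : Subset≤ k n → Bool) (d⊥ρ : ∀ w → ⟨ d , ρ w ⟩ ≡ false) where

        -- The potential ⟨ d , χ · ρ w ⟩, where χ says which cuts p → q crosses,
        -- is constant along an accepting walk: steps labelled p → q change ρ only
        -- where χ holds, so they change the potential by the difference of two
        -- ⟨ d , ρ w ⟩; all other steps change ρ only where χ fails.
        crossing-vanishes : ∀ {E} → Accepts W E → ∀ p q → SoleCrossing E p q → ⟨ d , crossing p q ⟩ ≡ false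
        crossing-vanishes {E} acc p q sole = begin
          ⟨ d , χ ⟩     ≡⟨ ⟨⟩-congʳ d (λ L → trans (sym (Bool.∧-identityʳ (χ L))) (cong (χ L ∧_) (sym (ρ-s′ L)))) ⟩
          Φ (s′ W)      ≡⟨ gfold isEquivalence Φ Φ-step acc ⟩
          Φ (t′ W)      ≡⟨ ⨁-false (λ L → trans (cong (λ b → d L ∧ χ L ∧ b) (ρ-t′ L))
                             (trans (cong (d L ∧_) (Bool.∧-zeroʳ (χ L))) (Bool.∧-zeroʳ (d L)))) ⟩
          false         ∎
          where
          open ≡-Reasoning

          χ : Subset≤ k n → Bool
          χ = crossing p q

          Φ Φᶜ : Fin (size W) → Bool
          Φ  w = ⟨ d , (λ L → χ L ∧ ρ w L) ⟩
          Φᶜ w = ⟨ d , (λ L → not (χ L) ∧ ρ w L) ⟩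

          ∧-split : ∀ b c → (b ∧ c) xor (not b ∧ c) ≡ c
          ∧-split true  c = Bool.xor-identityʳ c
          ∧-split false c = refl

          -- The two potentials add up to ⟨ d , ρ w ⟩ = 0, and over 𝔽₂ this makes them equal.
          Φ≡Φᶜ : ∀ w → Φ w ≡ Φᶜ w
          Φ≡Φᶜ w = xor≡false⇒≡ _ _ (trans
            (sym (⟨⟩-xorʳ d (λ L → χ L ∧ ρ w L) (λ L → not (χ L) ∧ ρ w L)))
            (trans (⟨⟩-congʳ d (λ L → ∧-split (χ L) (ρ w L))) (d⊥ρ w)))

          ∧-congʳ-if : ∀ b {c c′} → (b ≡ true → c ≡ c′) → b ∧ c ≡ b ∧ c′
          ∧-congʳ-if true  h = h refl
          ∧-congʳ-if false h = refl

          Φ-step : ∀ {x y} → Step W E x y → Φ x ≡ Φ y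
          Φ-step {x} {y} (e , eq , Ee)
            with proj₁ (label W e) ≟ p | proj₂ (label W e) ≟ q
          ... | no ≢p | _ = ⟨⟩-congʳ d λ L → ∧-congʳ-if (χ L) λ χL →
                ρ-step L (e , eq , sole Ee (≢p ∘ proj₁) L χL)
          ... | yes _ | no ≢q = ⟨⟩-congʳ d λ L → ∧-congʳ-if (χ L) λ χL →
                ρ-step L (e , eq , sole Ee (≢q ∘ proj₂) L χL)
          -- A step labelled p → q is available in every cut graph whose cut it does not cross, so
          -- it preserves the complementary potential.
          ... | yes refl | yes refl = trans (Φ≡Φᶜ x) (trans
                (⟨⟩-congʳ d (λ L → ∧-congʳ-if (not (χ L)) λ ¬χL → ρ-step L (e , eq , Bool.not-injective ¬χL)))
                (sym (Φ≡Φᶜ y)))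

    -- A `d` orthogonal to all reachability vectors kills the crossing indicators, hence by
    -- hypothesis all superset indicators, hence is zero by inversion. So the vectors have full
    -- rank.
    cut-independence⇒bound : (W : SwitchingNetwork N) → Sound source target W →
      (∀ (d : Subset≤ k n → Bool) →
        (∀ E → Accepts W E → ∀ p q → SoleCrossing E p q → ⟨ d , crossing p q ⟩ ≡ false) →
        ∀ (S : Subset≤ k n) → ⟨ d , S ⊆ᵇ_ ⟩ ≡ false) →
      suc (#subsets k n) ≤ size W
    -- The goal is a decidable inequality, so it may be proved under a double negation. Excluded
    -- middle for the finitely many pairs of vertex and cut then stands in for a reachability
    -- algorithm.
    cut-independence⇒bound W sound h = decidable-stable (_ ≤? _) (¬¬-map bound
      (¬¬-sequence λ w → ¬¬-sequence λ i → ¬¬-excluded-middle))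
      where
      bound : (∀ w i → Dec (EqClosure (Step W (cutGraph (decode i))) (s′ W) w)) → suc (#subsets k n) ≤ size W
      bound reach? = separating⇒suc-#subsets≤ (ρ W sound reachable?) (t′ W , ρ-t′ W sound reachable?)
        λ d d⊥ρ → superset-sums-vanish d (h d λ E acc p q → crossing-vanishes W sound reachable? d d⊥ρ acc p q)
        where
        reachable? : ∀ w L → Dec (EqClosure (Step W (cutGraph L)) (s′ W) w)
        reachable? w L = subst (λ L → Dec (EqClosure (Step W (cutGraph L)) (s′ W) w)) (decode-encode L) (reach? w (encode L))

    side-inner : ∀ L a → side L (inner a) ≡ L ∋ a
    side-inner L a = side-π⁻¹ L (suc (suc a))

    crossing-target : ∀ L p → crossing p target L ≡ side L p
    crossing-target L p = trans (cong (λ b → side L p ∧ not b) (side-π⁻¹ L zero)) (Bool.∧-identityʳ (side L p))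

    crossing-out : ∀ L {p q} → side L p ≡ false → crossing p q L ≡ false
    crossing-out L {q = q} p∉ = cong (_∧ not (side L q)) p∉

    crossing-in : ∀ L {p q} → side L q ≡ true → crossing p q L ≡ false
    crossing-in L {p} q∈ = trans (cong (λ b → side L p ∧ not b) q∈) (Bool.∧-zeroʳ (side L p))

    -- Path graphs of length at most three and the functions they supply.

    sole-st : SoleCrossing (pathGraph (source ∷ target ∷ [])) source target
    sole-st (zero , refl , refl) ≢st = contradiction (refl , refl) ≢st

    sole-sat : ∀ a → SoleCrossing (pathGraph (source ∷ inner a ∷ target ∷ [])) (inner a) target
    sole-sat a (zero     , refl , refl) _ L at =
      crossing-in L {source} (trans (sym (crossing-target L (inner a))) at)
    sole-sat a (suc zero , refl , refl) ≢at = contradiction (refl , refl) ≢at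

    -- A cut crossed by a → b contains a and omits b: s → a ends inside it and b → t starts outside.
    sole-sabt : ∀ a b → SoleCrossing (pathGraph (source ∷ inner a ∷ inner b ∷ target ∷ [])) (inner a) (inner b)
    sole-sabt a b (zero     , refl , refl) _ L ab =
      crossing-in L {source} (Bool.∧-conicalˡ (side L (inner a)) _ ab)
    sole-sabt a b (suc zero , refl , refl) ≢ab = contradiction (refl , refl) ≢ab
    sole-sabt a b (suc (suc zero) , refl , refl) _ L ab =
      crossing-out L {q = target} (Bool.not-injective (Bool.∧-conicalʳ (side L (inner a)) _ ab))

  π⁻¹-≢ : ∀ {i j} → i ≢ j → π ⟨$⟩ˡ i ≢ π ⟨$⟩ˡ j
  π⁻¹-≢ i≢j = i≢j ∘ π⁻¹-injective

  st∈𝒫 : pathGraph (source ∷ target ∷ []) ∈ 𝒫 source target 1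
  st∈𝒫 = pathGraph∈𝒫 _ ((π⁻¹-≢ (λ ()) ∷ []) ∷ [] ∷ []) refl refl

  sat∈𝒫 : ∀ a → pathGraph (source ∷ inner a ∷ target ∷ []) ∈ 𝒫 source target 2
  sat∈𝒫 a = pathGraph∈𝒫 _
    ((π⁻¹-≢ (λ ()) ∷ π⁻¹-≢ (λ ()) ∷ []) ∷ (π⁻¹-≢ (λ ()) ∷ []) ∷ [] ∷ []) refl refl

  sabt∈𝒫 : ∀ {a b} → a ≢ b → pathGraph (source ∷ inner a ∷ inner b ∷ target ∷ []) ∈ 𝒫 source target 3
  sabt∈𝒫 {a} {b} a≢b = pathGraph∈𝒫 _
    ((π⁻¹-≢ (λ ()) ∷ π⁻¹-≢ (λ ()) ∷ π⁻¹-≢ (λ ()) ∷ []) ∷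
     (π⁻¹-≢ {suc (suc a)} {suc (suc b)} (λ { refl → a≢b refl }) ∷ π⁻¹-≢ (λ ()) ∷ []) ∷
     (π⁻¹-≢ (λ ()) ∷ []) ∷ [] ∷ []) refl refl

  module _ {k : ℕ} (W : SwitchingNetwork N) (d : Subset≤ k n → Bool)
    (vanish : ∀ E → Accepts W E → ∀ p q → SoleCrossing {k} E p q → ⟨ d , crossing p q ⟩ ≡ false) where

    ∋-vanishes : AcceptsAll W (𝒫≤ source target 2) → ∀ a → ⟨ d , _∋ a ⟩ ≡ false
    ∋-vanishes acc a = trans
      (⟨⟩-congʳ d λ L → sym (trans (crossing-target L (inner a)) (side-inner L a)))
      (vanish _ (acc _ (2 , s≤s z≤n , ≤-refl , sat∈𝒫 a)) (inner a) target (sole-sat a))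

    ≤1-vanishes : AcceptsAll W (𝒫≤ source target 2) → ∀ (S : Subset≤ 1 n) → ⟨ d , S ⊆ᵇ_ ⟩ ≡ false
    ≤1-vanishes acc S with ⊆ᵇ-≤1 S
    -- Every cut is crossed by s → t, so its crossing indicator is the constant 1.
    ... | inj₁ S⊆ = trans
      (⟨⟩-congʳ d λ L → trans (S⊆ L) (sym (trans (crossing-target L source) (side-π⁻¹ L (suc zero)))))
      (vanish _ (acc _ (1 , s≤s z≤n , s≤s z≤n , st∈𝒫)) source target sole-st)
    ... | inj₂ (a , S⊆) = trans (⟨⟩-congʳ d S⊆) (∋-vanishes acc a)

    ≤2-vanishes : AcceptsAll W (𝒫≤ source target 3) → ∀ (S : Subset≤ 2 n) → ⟨ d , S ⊆ᵇ_ ⟩ ≡ false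
    ≤2-vanishes acc S with ⊆ᵇ-≤2 S
    ... | inj₁ (S′ , S⊆) = trans (⟨⟩-congʳ d S⊆) (≤1-vanishes (acceptsAll-anti W (n≤1+n 2) acc) S′)
    ... | inj₂ (a , b , a≢b , S⊆) = begin
      ⟨ d , S ⊆ᵇ_ ⟩
        -- [a, b ∈ L] is the sum of [a ∈ L] and [a ∈ L, b ∉ L].
        ≡⟨ ⟨⟩-congʳ d (λ L → trans (S⊆ L) (trans (∧-as-xor (L ∋ a) (L ∋ b)) (cong (L ∋ a xor_) (sym (crossing-ab L))))) ⟩
      ⟨ d , (λ L → L ∋ a xor crossing (inner a) (inner b) L) ⟩
        ≡⟨ ⟨⟩-xorʳ d (_∋ a) (crossing (inner a) (inner b)) ⟩
      ⟨ d , _∋ a ⟩ xor ⟨ d , crossing (inner a) (inner b) ⟩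
        ≡⟨ cong₂ _xor_ (∋-vanishes (acceptsAll-anti W (n≤1+n 2) acc) a)
             (vanish _ (acc _ (3 , s≤s z≤n , ≤-refl , sabt∈𝒫 a≢b)) (inner a) (inner b) (sole-sabt a b)) ⟩
      false ∎
      where
      open ≡-Reasoning

      crossing-ab : ∀ L → crossing (inner a) (inner b) L ≡ L ∋ a ∧ not (L ∋ b)
      crossing-ab L = cong₂ (λ x y → x ∧ not y) (side-inner L a) (side-inner L b)

      ∧-as-xor : ∀ x y → x ∧ y ≡ x xor (x ∧ not y)
      ∧-as-xor false y = refl
      ∧-as-xor true  y = sym (Bool.not-involutive y)

  ≤2-lower-bound : ∀ W → Sound source target W → AcceptsAll W (𝒫≤ source target 2) →
    suc (#subsets 1 n) ≤ size W
  ≤2-lower-bound W sound acc = cut-independence⇒bound W sound λ d vanish → ≤1-vanishes W d vanish acc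

  ≤3-lower-bound : ∀ W → Sound source target W → AcceptsAll W (𝒫≤ source target 3) →
    suc (#subsets 2 n) ≤ size W
  ≤3-lower-bound W sound acc = cut-independence⇒bound W sound λ d vanish → ≤2-vanishes W d vanish acc

  -- Upper bound: the network of known sets.

  -- A state is t′ = zero or a set S of vertices known to be reachable from s.
  -- An edge whose tail is not known is a loop.
  module Knowledge (k : ℕ) where

    -- Triples are edges learning one inner vertex, so their sets have at most `k` elements; pairs
    -- are edges into t′. The tail of a learning edge is stored through `punchIn`, which skips the
    -- head, so no label is a loop.
    Edge : Set
    Edge = (Subset≤ k n × Fin n × Fin n) ⊎ (Subset≤ (suc k) n × Fin (suc n))

    edges : Fin (#subsets k n * (n * n) + #subsets (suc k) n * suc n) ↔ Edge
    edges = ↔-trans +↔⊎ (↔-trans *↔× (enumerate k n ×-↔ *↔×) ⊎-↔ ↔-trans *↔× (enumerate (suc k) n ×-↔ ↔-refl))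

    open Inverse edges using () renaming (to to decodeEdge; from to encodeEdge; strictlyInverseˡ to decode-encodeEdge)

    State : Set
    State = Fin (suc (#subsets (suc k) n))

    state : Subset≤ (suc k) n → State
    state S = suc (encode S)

    ends : Edge → State × State
    ends (inj₁ (S , i , p′)) =
      state (raise S) , (if keep S ∋ punchIn (suc i) p′ then state (insert i S) else state (raise S))
    ends (inj₂ (S , p)) = state S , (if keep {suc k} S ∋ p then zero else state S)

    edgeLabel : Edge → Fin N × Fin N
    edgeLabel (inj₁ (S , i , p′)) = vertex (punchIn (suc i) p′) , inner i
    edgeLabel (inj₂ (S , p))      = vertex p , target

    edgeLabel-≢ : ∀ e → proj₁ (edgeLabel e) ≢ proj₂ (edgeLabel e)
    edgeLabel-≢ (inj₁ (S , i , p′)) eq = punchInᵢ≢i (suc i) p′ (suc-injective (π⁻¹-injective eq))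
    edgeLabel-≢ (inj₂ (S , p))      eq = 0≢1+n (sym (π⁻¹-injective eq))

    network : SwitchingNetwork N
    network = record
      { size      = suc (#subsets (suc k) n)
      ; s′        = state ∅
      ; t′        = zero
      ; #edges    = _
      ; endpoints = ends ∘ decodeEdge
      ; label     = edgeLabel ∘ decodeEdge
      ; label-≢   = edgeLabel-≢ ∘ decodeEdge
      }

    module _ (E : InputGraph N) where

      Known : Subset≤ (suc k) n → Set
      Known S = ∀ p → keep S ∋ p ≡ true → HasPath E source (vertex p)

      -- An invariant for soundness: usable edges join states of equivalent meaning when s does not
      -- reach t. The meaning of s′ is true and that of t′ absurd.
      Meaning : State → Set
      Meaning zero    = ⊥
      Meaning (suc c) = Known (decode c)

      Meaning-state : ∀ S → Meaning (state S) ≡ Known S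
      Meaning-state S = cong Known (decode-encode S)

      -- Edges of G′ are traversed both ways, so an equivalence is needed: a path to `p` extends
      -- along p → i, and conversely the smaller set claims less.
      known-insert : ∀ S i p → keep S ∋ p ≡ true → E (vertex p) (inner i) → Known (raise S) ⇔ Known (insert i S)
      known-insert S i p p∈ Epi = mk⇔ learn forget
        where
        learn : Known (raise S) → Known (insert i S)
        learn K zero    _ = K zero refl
        learn K (suc j) j∈ with j ≟ i
        ... | yes refl = K p (trans (weaken-∋ (s≤s (n≤1+n k)) (keep S) p) p∈) ◅◅ (Epi ◅ ε)
        ... | no  j≢i  = K (suc j) (trans (weaken-∋ _ S j) (trans (sym (insert-∋-other S j≢i)) j∈))

        forget : Known (insert i S) → Known (raise S)
        forget K zero    _  = K zero refl
        forget K (suc j) j∈ = K (suc j) (insert-∋-mono i S (trans (sym (weaken-∋ _ S j)) j∈))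

      module _ (no-path : ¬ HasPath E source target) where

        open IsEquivalence (⇔-isEquivalence {ℓ = 0ℓ}) using () renaming (refl to ⇔-refl)

        ends-meaning : ∀ e → E (proj₁ (edgeLabel e)) (proj₂ (edgeLabel e)) →
          Meaning (proj₁ (ends e)) ⇔ Meaning (proj₂ (ends e))
        ends-meaning (inj₁ (S , i , p′)) Ee with keep S ∋ punchIn (suc i) p′ in p∈
        ... | false = ⇔-refl
        ... | true  = subst₂ _⇔_ (sym (Meaning-state (raise S))) (sym (Meaning-state (insert i S)))
                        (known-insert S i (punchIn (suc i) p′) p∈ Ee)
        ends-meaning (inj₂ (S , p)) Ee with keep {suc k} S ∋ p in p∈
        ... | false = ⇔-refl
        -- Both sides are absurd: a path to `p` followed by p → t would join s to t.
        ... | true  = mk⇔ (λ K → no-path (subst id (Meaning-state S) K p p∈ ◅◅ (Ee ◅ ε))) (λ ())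

        step-meaning : ∀ {x y} → Step network E x y → Meaning x ⇔ Meaning y
        step-meaning (e , refl , Ee) = ends-meaning (decodeEdge e) Ee

        rejects : ¬ Accepts network E
        rejects acc = Equivalence.to (gfold ⇔-isEquivalence Meaning step-meaning acc)
          (subst id (sym (Meaning-state ∅)) λ
            { zero _ → ε ; (suc j) j∈ → contradiction (trans (sym j∈) (∅-∋ j)) λ () })

      edge-step : ∀ e → E (proj₁ (edgeLabel e)) (proj₂ (edgeLabel e)) →
        Step network E (proj₁ (ends e)) (proj₂ (ends e))
      edge-step e Ee = encodeEdge e , cong ends (decode-encodeEdge e) ,
        subst (λ e → E (proj₁ (edgeLabel e)) (proj₂ (edgeLabel e))) (sym (decode-encodeEdge e)) Ee

      learn-step : ∀ S i p → keep S ∋ p ≡ true → suc i ≢ p → E (vertex p) (inner i) →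
        Step network E (state (raise S)) (state (insert i S))
      learn-step S i p p∈ i≢p Epi =
        subst (Step network E (state (raise S)))
          (cong (if_then state (insert i S) else state (raise S)) (trans (cong (keep S ∋_) (punchIn-punchOut i≢p)) p∈))
          (edge-step (inj₁ (S , i , punchOut i≢p))
            (subst (λ q → E (vertex q) (inner i)) (sym (punchIn-punchOut i≢p)) Epi))

      finish-step : ∀ S p → keep {suc k} S ∋ p ≡ true → E (vertex p) target → Step network E (state S) zero
      finish-step S p p∈ Ept =
        subst (Step network E (state S)) (cong (if_then zero else state S) p∈) (edge-step (inj₂ (S , p)) Ept)

      -- Induction along the walk with its current vertex known. Here `m` bounds the vertices
      -- learned and `l` counts the edges left; all but the last edge may cost one vertex, hence m +
      -- l ≤ k + 2. An already known next vertex costs nothing.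
      walk-accepted : ∀ {l} (u : Fin (suc l) → Fin N) →
        (∀ i → E (u (inject₁ i)) (u (suc i))) → u (fromℕ l) ≡ target →
        ∀ {m} (S : Subset≤ m n) (m≤1+k : m ≤ suc k) → m + l ≤ suc (suc k) →
        skip (keep S) ∋ (π ⟨$⟩ʳ u zero) ≡ true →
        EqClosure (Step network E) (state (weaken m≤1+k S)) zero
      walk-accepted {zero} u Eu uₗ≡t S _ _ u₀∈ =
        case trans (sym u₀∈) (cong (skip (keep S) ∋_) (trans (cong (π ⟨$⟩ʳ_) uₗ≡t) (inverseʳ π))) of λ ()
      walk-accepted {suc l} u Eu uₗ≡t {m} S m≤1+k m+l≤ u₀∈
        with skip (keep S) ∋ (π ⟨$⟩ʳ u (suc zero)) in u₁∈
      ... | true  = walk-accepted (u ∘ suc) (Eu ∘ suc) uₗ≡t S m≤1+k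
                      (≤-trans (+-monoʳ-≤ m (n≤1+n l)) m+l≤) u₁∈
      ... | false = advance (π ⟨$⟩ʳ u zero) (π ⟨$⟩ʳ u (suc zero)) refl refl u₀∈ u₁∈ (Eu zero)
        where
        π⁻¹≡ : ∀ {v i} → π ⟨$⟩ʳ v ≡ i → v ≡ π ⟨$⟩ˡ i
        π⁻¹≡ eq = trans (sym (inverseˡ π)) (cong (π ⟨$⟩ˡ_) eq)

        -- The cases `x = zero` and `y = suc zero` are absurd, as t is never known and s always is.
        advance : ∀ x y → π ⟨$⟩ʳ u zero ≡ x → π ⟨$⟩ʳ u (suc zero) ≡ y →
          skip (keep S) ∋ x ≡ true → skip (keep S) ∋ y ≡ false → E (u zero) (u (suc zero)) →
          EqClosure (Step network E) (state (weaken m≤1+k S)) zero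
        advance (suc p) zero u₀≡ u₁≡ p∈ _ E₀₁ =
          fwd (finish-step (weaken m≤1+k S) p (trans (weaken-∋ (s≤s m≤1+k) (keep S) p) p∈)
                (subst₂ E (π⁻¹≡ u₀≡) (π⁻¹≡ u₁≡) E₀₁)) ◅ ε
        advance (suc p) (suc (suc i)) u₀≡ u₁≡ p∈ i∉ E₀₁ = extend l (u ∘ suc) (Eu ∘ suc) uₗ≡t m+l≤ u₁≡
          where
          -- The vertex just reached is inner, so the walk cannot end there. One more edge remains,
          -- and the budget m + 2 ≤ k + 2 leaves room for `i`.
          extend : ∀ l (w : Fin (suc l) → Fin N) → (∀ i → E (w (inject₁ i)) (w (suc i))) → w (fromℕ l) ≡ target →
            m + suc l ≤ suc (suc k) → π ⟨$⟩ʳ w zero ≡ suc (suc i) →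
            EqClosure (Step network E) (state (weaken m≤1+k S)) zero
          extend zero    w _  w₀≡t _ w₀≡ =
            case trans (sym w₀≡) (trans (cong (π ⟨$⟩ʳ_) w₀≡t) (inverseʳ π)) of λ ()
          extend (suc l) w Ew wₗ≡t m+2+l≤ w₀≡ =
            subst₂ (λ S T → EqClosure (Step network E) (state S) (state T))
              (weaken-weaken m≤k (n≤1+n k) m≤1+k S) (sym (weaken-insert m≤k i S))
              (fwd (learn-step (weaken m≤k S) i p (trans (weaken-∋ (s≤s m≤k) (keep S) p) p∈) i≢p
                     (subst₂ E (π⁻¹≡ u₀≡) (π⁻¹≡ u₁≡) E₀₁)) ◅ ε)
            ◅◅ walk-accepted w Ew wₗ≡t (insert i S) (s≤s m≤k)
                 (subst (_≤ suc (suc k)) (+-suc m (suc l)) m+2+l≤)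
                 (trans (cong (skip (keep (insert i S)) ∋_) w₀≡) (insert-∋-self i S))
            where
            m≤k : m ≤ k
            m≤k = s≤s⁻¹ (s≤s⁻¹ (≤-trans (≤-trans (m≤m+n (suc (suc m)) l)
                    (≤-reflexive (sym (trans (+-suc m (suc l)) (cong suc (+-suc m l)))))) m+2+l≤))

            i≢p : suc i ≢ p
            i≢p refl = case trans (sym p∈) i∉ of λ ()

    network-sound : Sound source target network
    network-sound E no-path = rejects E no-path

    network-accepts : AcceptsAll network (𝒫≤ source target (suc (suc k)))
    network-accepts E (j , _ , j≤2+k , v , _ , v₀≡s , vⱼ≡t , E⇔) =
      subst (λ S → EqClosure (Step network E) (state S) zero) (weaken-∅ z≤n n)
        (walk-accepted E v (λ i → Equivalence.from (E⇔ _ _) (i , refl , refl)) vⱼ≡t (∅ {0}) z≤n j≤2+k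
          (trans (cong (skip (keep ∅) ∋_) (trans (cong (π ⟨$⟩ʳ_) v₀≡s) (inverseʳ π))) refl))

-- Numbering the vertices and counting the inner ones.

insert-at : ∀ {m n} i j (π : Permutation m n) → Perm.insert i j π ⟨$⟩ʳ i ≡ j
insert-at i j π rewrite proj₂ (dec-yes (i ≟ i) refl) = refl

-- First t is sent to 0; among the remaining vertices s is then sent to 0, which is 1 in the full
-- numbering.
∃-numbering : ∀ {n} {s t : Fin (suc (suc n))} → s ≢ t →
  ∃[ π ] source {suc (suc n)} {n} π ≡ s × target π ≡ t
∃-numbering {n} {s} {t} s≢t = π , π⁻¹≡ πs≡1 , π⁻¹≡ (insert-at t zero π′)
  where
  t≢s : t ≢ s
  t≢s = s≢t ∘ sym

  π′ : Permutation (suc n) (suc n)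
  π′ = Perm.insert (punchOut t≢s) zero Perm.id

  π : Permutation (suc (suc n)) (suc (suc n))
  π = Perm.insert t zero π′

  πs≡1 : π ⟨$⟩ʳ s ≡ suc zero
  πs≡1 = begin
    π ⟨$⟩ʳ s                          ≡⟨ cong (π ⟨$⟩ʳ_) (punchIn-punchOut t≢s) ⟨
    π ⟨$⟩ʳ punchIn t (punchOut t≢s)   ≡⟨ insert-punchIn t zero π′ (punchOut t≢s) ⟩
    suc (π′ ⟨$⟩ʳ punchOut t≢s)        ≡⟨ cong suc (insert-at (punchOut t≢s) zero Perm.id) ⟩
    suc zero                          ∎
    where open ≡-Reasoning

  π⁻¹≡ : ∀ {v i} → π ⟨$⟩ʳ v ≡ i → π ⟨$⟩ˡ i ≡ v
  π⁻¹≡ refl = inverseˡ π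

∣p∣≡1+∣p-x∣ : ∀ {n} {p : Subset n} {x} → x ∈ₛ p → ∣ p ∣ ≡ suc ∣ p - x ∣
∣p∣≡1+∣p-x∣ {p = inside ∷ p}  here        = cong (suc ∘ ∣_∣) (sym (p─⊥≡p p))
∣p∣≡1+∣p-x∣ {p = inside ∷ p}  (there x∈p) = cong suc (∣p∣≡1+∣p-x∣ x∈p)
∣p∣≡1+∣p-x∣ {p = outside ∷ p} (there x∈p) = ∣p∣≡1+∣p-x∣ x∈p

-- Deleting s and then t lowers the count by one each time, since t ≠ s is still present after the
-- first deletion.
2+∣⊤─st∣≡N : ∀ {N} {s t : Fin N} → s ≢ t → N ≡ suc (suc ∣ ⊤ ─ (⁅ s ⁆ ∪ ⁅ t ⁆) ∣)
2+∣⊤─st∣≡N {N} {s} {t} s≢t = begin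
  N                                     ≡⟨ ∣⊤∣≡n N ⟨
  ∣ ⊤ {N} ∣                             ≡⟨ ∣p∣≡1+∣p-x∣ {x = s} ∈⊤ ⟩
  suc ∣ ⊤ - s ∣                         ≡⟨ cong suc (∣p∣≡1+∣p-x∣ (x∈p∧x≢y⇒x∈p-y ∈⊤ (s≢t ∘ sym))) ⟩
  suc (suc ∣ ⊤ - s - t ∣)               ≡⟨ cong (λ p → suc (suc ∣ p ∣)) (p─q─r≡p─q∪r ⊤ ⁅ s ⁆ ⁅ t ⁆) ⟩
  suc (suc ∣ ⊤ ─ (⁅ s ⁆ ∪ ⁅ t ⁆) ∣)     ∎
  where open ≡-Reasoning

m-values : ∀ {N n} {s t : Fin N} → N ≡ suc (suc n) → s ≢ t →
  (m⟨ s , t ⟩ 𝒫≤ s t 2 ≈ suc (#subsets 1 n)) × (m⟨ s , t ⟩ 𝒫≤ s t 3 ≈ suc (#subsets 2 n))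
m-values refl s≢t with ∃-numbering s≢t
... | π , refl , refl =
    -- `network k` holds sets of at most k + 1 vertices and accepts paths of at most k + 2 edges.
    record { attained = network 0 , network-sound 0 , network-accepts 0 , refl ; minimal = ≤2-lower-bound π }
  , record { attained = network 1 , network-sound 1 , network-accepts 1 , refl ; minimal = ≤3-lower-bound π }
  where open Knowledge π

theorem3p16 : ∀ (N : ℕ) (s t : Fin N) → s ≢ t →
    ∀ (n : ℕ) → n ≡ ∣ ⊤ ─ (⁅ s ⁆ ∪ ⁅ t ⁆) ∣ →
    (m⟨ s , t ⟩ 𝒫≤ s t 2 ≈ (n + 2)) × (m⟨ s , t ⟩ 𝒫≤ s t 3 ≈ (n C 2 + n + 2))
theorem3p16 N s t s≢t n refl =
  subst₂ (λ a b → (m⟨ s , t ⟩ 𝒫≤ s t 2 ≈ a) × (m⟨ s , t ⟩ 𝒫≤ s t 3 ≈ b))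
    (trans (cong suc (#subsets-1 n)) (sym (+-suc n 1)))
    (trans (cong suc (#subsets-2 n)) (sym (+-suc (n C 2 + n) 1)))
    (m-values (2+∣⊤─st∣≡N s≢t) s≢t)
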